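{- Let $D$ be a semicomplete multipartite digraph and let $F$ be a 1-path-cycle factor in $D$. Let $P$ denote the path in $F$ and assume that the initial and terminal vertices of $P$ belong to different partite sets of $D$. Then $D$ contains a Hamilton (directed) path whose initial and terminal vertices belong to different partite sets.
   Context: A semicomplete $p$-partite (multipartite) digraph ($p\ge 2$) is obtained from a complete $p$-partite graph by replacing each edge $\{x,y\}$ by the arc $xy$, the arc $yx$, or both arcs; its partite sets are the maximal independent sets. A 1-path-cycle factor of a digraph $H$ is a spanning subdigraph of $H$ consisting of one non-empty directed path and a possibly empty collection of directed cycles, all vertex-disjoint. -}

module Defs where

open import Level using (Level; suc; _⊔_)
open import Data.Nat using (ℕ; _≤_)
open import Data.Fin using (Fin)
open import Data.List using (List; []; _∷_; _++_; concatMap)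
open import Data.List.NonEmpty using (List⁺; toList; head; last)
open import Data.List.Relation.Binary.Permutation.Propositional using (_↭_)
open import Data.Fin.Base using () 
open import Data.List using () renaming (allFin to allFinL)
open import Data.List.Relation.Unary.All using (All)
open import Data.Product using (Σ; _×_)
open import Data.Sum using (_⊎_)
open import Data.Unit.Polymorphic using (⊤)
open import Function.Definitions using (Surjective)
open import Relation.Binary.PropositionalEquality using (_≡_; _≢_)
open import Relation.Nullary using (¬_)

Digraph : ℕ → Set₁
Digraph n = Fin n → Fin n → Set

-- Semicomplete p-partite digraph with p ≥ 2: the vertex set is partitioned
-- into p non-empty partite sets (colour classes of a surjective map
-- part : Fin n → Fin p); no arcs inside a partite set (in particular no
-- loops), and between any two vertices of different partite sets there is
-- at least one arc (xy, yx or both).  The colour classes are then exactly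
-- the maximal independent sets.
record SemicompleteMultipartite {n : ℕ} (D : Digraph n) : Set where
  field
    p        : ℕ
    2≤p      : 2 ≤ p
    part     : Fin n → Fin p
    part-onto : Surjective _≡_ _≡_ part
    indep    : ∀ x y → part x ≡ part y → ¬ D x y
    complete : ∀ x y → part x ≢ part y → D x y ⊎ D y x

Consec : ∀ {n} → Digraph n → List (Fin n) → Set
Consec D []           = ⊤
Consec D (x ∷ [])     = ⊤
Consec D (x ∷ y ∷ xs) = D x y × Consec D (y ∷ xs)

-- A directed walk along a non-empty vertex sequence (distinctness of
-- vertices is imposed by the spanning conditions below).
IsWalk : ∀ {n} → Digraph n → List⁺ (Fin n) → Set
IsWalk D P = Consec D (toList P)

IsCycle : ∀ {n} → Digraph n → List⁺ (Fin n) → Set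
IsCycle D C = Consec D (toList C) × D (last C) (head C)

record OnePathCycleFactor {n : ℕ} (D : Digraph n) : Set where
  field
    path      : List⁺ (Fin n)
    cycles    : List (List⁺ (Fin n))
    path-ok   : IsWalk D path
    cycles-ok : All (IsCycle D) cycles
    spanning  : (toList path ++ concatMap toList cycles) ↭ allFinL n

record HamiltonPath {n : ℕ} (D : Digraph n) : Set where
  field
    path     : List⁺ (Fin n)
    path-ok  : IsWalk D path
    spanning : toList path ↭ allFinL n

{-# OPTIONS --safe #-}
module Submission where

-- The cycles are absorbed into the path one at a time, so let C be a single
-- cycle and P = p₁ … pₘ; write c⁻ and c⁺ for the neighbours of c on C and put
-- pₘ₊₁ := p₁.  Unless P and C already merge, every arc pⱼ → c satisfies
-- colour c⁻ ≡ colour pⱼ₊₁.  For j = m this holds because p₁ … pₘ c … c⁻ is not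
-- a solution, and it descends from j + 1 and j + 2 to j because otherwise
-- p₁ … pⱼ c … c⁻⁻ pⱼ₊₁ c⁻ pⱼ₊₂ … pₘ would be a path.  Given this property at
-- j = 1, 2, some c has arcs c → p₁ → c⁺ → p₂, and c⁺⁺ … c p₁ c⁺ p₂ … pₘ
-- is a path whose ends have different colours.

open import Defs
open import Data.Fin.Properties using (_≟_)
open import Data.Empty using (⊥-elim)
open import Data.List using (List; []; _∷_; _++_; _∷ʳ_; [_]; concatMap; initLast; _∷ʳ′_)
open import Data.List.NonEmpty using (_∷_; toList; head; last)
open import Data.List.Properties using (++-assoc; ++-identityʳ)
open import Data.List.Relation.Binary.Permutation.Propositional
  using (_↭_; ↭-refl; ↭-sym; ↭-trans; ↭-reflexive)
open import Data.List.Relation.Binary.Permutation.Propositional.Properties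
  using (++-commutativeMonoid; ++⁺; ++⁺ʳ; ∷↭∷ʳ)
open import Data.List.Relation.Unary.All using (All; []; _∷_)
open import Data.Nat using (ℕ)
open import Data.Product using (Σ; ∃; ∃₂; _×_; _,_; proj₂)
open import Data.Sum using (_⊎_; inj₁; inj₂)
open import Data.Unit.Polymorphic using (tt)
open import Relation.Binary.Definitions using (DecidableEquality)
open import Relation.Binary.PropositionalEquality
  using (_≡_; _≢_; refl; sym; trans; cong; subst)
open import Relation.Nullary using (yes; no)

import Algebra.Solver.CommutativeMonoid as CommutativeMonoidSolver

module Merging {V A : Set} (D : V → V → Set) (colour : V → A)
  (_≟ᶜ_ : DecidableEquality A)
  (arc⇒≢ : ∀ {x y} → D x y → colour x ≢ colour y)
  (complete : ∀ x y → colour x ≢ colour y → D x y ⊎ D y x) where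

  open CommutativeMonoidSolver (++-commutativeMonoid {A = V}) using (solve; _⊕_; _⊜_)

  infix 4 _≁_

  _≁_ : V → V → Set
  x ≁ y = colour x ≢ colour y

  -- Walks, and cycles cut open at an arc or around a vertex.

  data Walk : V → V → List V → Set where
    ⟨_⟩ : ∀ x → Walk x x [ x ]
    _∷_ : ∀ {x y z l} → D x y → Walk y z l → Walk x z (x ∷ l)

  infixr 5 _++⟨_⟩_

  _++⟨_⟩_ : ∀ {u v w z l m} → Walk u v l → D v w → Walk w z m → Walk u z (l ++ m)
  ⟨ _ ⟩   ++⟨ e ⟩ q = e ∷ q
  (d ∷ p) ++⟨ e ⟩ q = d ∷ (p ++⟨ e ⟩ q)

  unsnoc : ∀ {x y v l} → D x y → Walk y v l →
           ∃₂ λ w m → Walk x w m × D w v × x ∷ l ≡ m ∷ʳ v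
  unsnoc d ⟨ _ ⟩ = _ , _ , ⟨ _ ⟩ , d , refl
  unsnoc d (e ∷ p) with unsnoc e p
  ... | _ , _ , q , f , eq = _ , _ , d ∷ q , f , cong (_ ∷_) eq

  BichromaticPath : List V → Set
  BichromaticPath N = ∃₂ λ u v → ∃ λ l → Walk u v l × l ↭ N × u ≁ v

  -- Tying `vertices` to `K` only up to permutation lets every rotation of a cycle be an opening
  -- over the same `K`.
  record CycleThrough (K : List V) (b c : V) : Set where
    constructor cycle
    field
      {vertices} : List V
      walk       : Walk c b vertices
      arc        : D b c
      perm       : vertices ↭ K

  -- Detaching `b` leaves it free to be moved elsewhere. On a 2-cycle `a` and `c` coincide.
  record CycleAround (K : List V) (a b c : V) : Set where
    constructor cycle
    field
      {others} : List V
      walk     : Walk c a others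
      in-arc   : D a b
      out-arc  : D b c
      perm     : b ∷ others ↭ K

    via-in : CycleThrough K a b
    via-in = cycle (out-arc ∷ walk) in-arc perm

    via-out : CycleThrough K b c
    via-out = cycle (walk ++⟨ in-arc ⟩ ⟨ b ⟩) out-arc (↭-trans (↭-sym (∷↭∷ʳ b others)) perm)

  open CycleThrough using (arc)
  open CycleAround using (via-in; via-out)

  predecessor : ∀ {K b c} → CycleThrough K b c → ∃ λ a → CycleAround K a b c
  predecessor (cycle ⟨ _ ⟩ e _) = ⊥-elim (arc⇒≢ e refl)
  predecessor {b = b} (cycle (d ∷ p) e perm) with unsnoc d p
  ... | _ , m , q , f , eq =
    _ , cycle q f e (↭-trans (∷↭∷ʳ b m) (↭-trans (↭-reflexive (sym eq)) perm))

  successor : ∀ {K a b} → CycleThrough K a b → ∃ λ c → CycleAround K a b c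
  successor (cycle ⟨ _ ⟩ e _)      = ⊥-elim (arc⇒≢ e refl)
  successor (cycle (d ∷ p) e perm) = _ , cycle p e d perm

  -- Merging a path with one cycle.

  module _ {s t : V} {L K : List V} (s≁t : s ≁ t) where

    Goal : Set
    Goal = BichromaticPath (L ++ K)

    splice : ∀ {x y l₁ l₂ b c} → Walk s x l₁ → Walk y t l₂ → l₁ ++ l₂ ↭ L →
             CycleThrough K b c → D x c → D b y → Goal
    splice {l₁ = l₁} {l₂} p₁ p₂ perm (cycle {l} q _ permC) d e =
      _ , _ , _ , p₁ ++⟨ d ⟩ q ++⟨ e ⟩ p₂ ,
      ↭-trans (solve 3 (λ x y z → x ⊕ z ⊕ y ⊜ (x ⊕ y) ⊕ z) ↭-refl l₁ l₂ l)
              (++⁺ perm permC) ,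
      s≁t

    append : ∀ {b c} → Walk s t L → CycleThrough K b c → D t c → s ≁ b → Goal
    append p (cycle q _ permC) d s≁b = _ , _ , _ , p ++⟨ d ⟩ q , ++⁺ ↭-refl permC , s≁b

    prepend : ∀ {b c} → Walk s t L → CycleThrough K b c → D b s → c ≁ t → Goal
    prepend p (cycle {l} q _ permC) d c≁t =
      _ , _ , _ , q ++⟨ d ⟩ p ,
      ↭-trans (solve 2 (λ x y → x ⊕ y ⊜ y ⊕ x) ↭-refl l L) (++⁺ ↭-refl permC) , c≁t

    -- The new order is `x`, `c` ... `a`, `y`, `b`, `z`: the detached `b` lands one place further
    -- along the path than the rest of the cycle.
    exchange : ∀ {x y z l₁ l₂ a b c} → Walk s x l₁ → Walk z t l₂ → l₁ ++ y ∷ l₂ ↭ L →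
               CycleAround K a b c → D x c → D a y → D y b → D b z → Goal
    exchange {y = y} {l₁ = l₁} {l₂} {b = b} p₁ p₂ perm (cycle {l} q _ _ permC) d e f g =
      _ , _ , _ , p₁ ++⟨ d ⟩ q ++⟨ e ⟩ f ∷ g ∷ p₂ ,
      ↭-trans (solve 5 (λ u v w y b → u ⊕ w ⊕ y ⊕ b ⊕ v ⊜ (u ⊕ y ⊕ v) ⊕ b ⊕ w)
                ↭-refl l₁ l₂ l [ y ] [ b ])
              (++⁺ perm permC) ,
      s≁t

    exchange-end : ∀ {x l₁ a b c} → Walk s x l₁ → l₁ ∷ʳ t ↭ L →
                   CycleAround K a b c → D x c → D a t → D t b → s ≁ b → Goal
    exchange-end {l₁ = l₁} {b = b} p₁ perm (cycle {l} q _ _ permC) d e f s≁b =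
      _ , _ , _ , p₁ ++⟨ d ⟩ q ++⟨ e ⟩ f ∷ ⟨ b ⟩ ,
      ↭-trans (solve 4 (λ u w t b → u ⊕ w ⊕ t ⊕ b ⊜ (u ⊕ t) ⊕ b ⊕ w)
                ↭-refl l₁ l [ t ] [ b ])
              (++⁺ perm permC) ,
      s≁b

    -- The new order is `c` ... `a`, `s`, `b`, `y` ... `t`, so `c` becomes the initial vertex.
    exchange-start : ∀ {y l₂ a b c} → Walk y t l₂ → s ∷ l₂ ↭ L →
                     CycleAround K a b c → D a s → D s b → D b y → c ≁ t → Goal
    exchange-start {l₂ = l₂} {b = b} p₂ perm (cycle {l} q _ _ permC) d e f c≁t =
      _ , _ , _ , q ++⟨ d ⟩ e ∷ f ∷ p₂ ,
      ↭-trans (solve 4 (λ u w s b → w ⊕ s ⊕ b ⊕ u ⊜ (s ⊕ u) ⊕ b ⊕ w)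
                ↭-refl l₂ l [ s ] [ b ])
              (++⁺ perm permC) ,
      c≁t

    -- Used with x = pⱼ and q = pⱼ₊₁, where pₘ₊₁ = p₁ although pₘ → p₁ need not be an arc.
    Rigid : V → V → Set
    Rigid x q = ∀ {b c} → CycleThrough K b c → D x c → Goal ⊎ colour b ≡ colour q

    -- Rigidity gives `b` the colour of `q`, so `b` and `x` are adjacent. An arc from `x` to `b`
    -- would give the predecessor of `b` that colour too, although an arc joins it to `b`.
    rigid⇒back : ∀ {x q b c} → q ≁ x → Rigid x q → CycleThrough K b c → D x c → Goal ⊎ D b x
    rigid⇒back {x} {q} {b} q≁x rigid C d with rigid C d
    ... | inj₁ goal = inj₁ goal
    ... | inj₂ b~q with complete b x (λ b~x → q≁x (trans (sym b~q) b~x))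
    ...   | inj₁ e = inj₂ e
    ...   | inj₂ e with predecessor C
    ...     | _ , C′ with rigid (via-in C′) e
    ...       | inj₁ goal = inj₁ goal
    ...       | inj₂ a~q = ⊥-elim (arc⇒≢ (arc (via-in C′)) (trans a~q (sym b~q)))

    -- When `b` and `y` differ in colour, an arc from `b` to `y` lets the whole cycle be spliced in.
    -- For an arc from `y` to `b`, rigidity of `y` gives the predecessor of `b` the colour of `q`
    -- and an arc to `y`, which prepares the exchange.
    rigid-step : ∀ {x y q} → q ≁ y → Rigid y q →
                 (∀ {b c} → CycleThrough K b c → D x c → D b y → Goal) →
                 (∀ {a b c} → CycleAround K a b c → D x c → D a y → D y b → b ≁ q → Goal) →
                 Rigid x y
    rigid-step {y = y} q≁y rigid spliced exchanged {b} C d with colour b ≟ᶜ colour y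
    ... | yes b~y = inj₂ b~y
    ... | no b≁y with complete b y b≁y
    ...   | inj₁ e = inj₁ (spliced C d e)
    ...   | inj₂ e with predecessor C
    ...     | _ , C′ with rigid (via-in C′) e | rigid⇒back q≁y rigid (via-in C′) e
    ...       | inj₁ goal | _ = inj₁ goal
    ...       | inj₂ _ | inj₁ goal = inj₁ goal
    ...       | inj₂ a~q | inj₂ f =
      inj₁ (exchanged C′ d f e λ b~q → arc⇒≢ (arc (via-in C′)) (trans a~q (sym b~q)))

    -- Two consecutive cycle vertices cannot both have the colour of `s`, so some cycle vertex is
    -- adjacent to `s`. If the arc leaves `s`, `rigid⇒back` supplies one entering it.
    cycle-into-start : ∀ {y b c} → y ≁ s → Rigid s y → CycleThrough K b c →
                       Goal ⊎ ∃₂ λ b c → CycleThrough K b c × D b s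
    cycle-into-start {y} y≁s rigid-s C with non-similar C
      where
      non-similar : ∀ {b c} → CycleThrough K b c → ∃₂ λ a b → CycleThrough K a b × b ≁ s
      non-similar {b} {c} C with colour c ≟ᶜ colour s
      ... | no c≁s = _ , _ , C , c≁s
      ... | yes c~s with predecessor C
      ...   | _ , C′ = _ , _ , via-in C′ , λ b~s → arc⇒≢ (arc C) (trans b~s (sym c~s))
    ... | _ , b , C′ , b≁s with complete b s b≁s
    ...   | inj₁ e = inj₂ (_ , _ , via-out (successor C′ .proj₂) , e)
    ...   | inj₂ e with rigid⇒back y≁s rigid-s C′ e
    ...     | inj₁ goal = inj₁ goal
    ...     | inj₂ f = inj₂ (_ , _ , C′ , f)

    -- Rigidity along the whole path.

    module _ (P : Walk s t L) where

      rigid-end : Rigid t s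
      rigid-end {b} C d with colour b ≟ᶜ colour s
      ... | yes b~s = inj₂ b~s
      ... | no b≁s = inj₁ (append P C d λ s~b → b≁s (sym s~b))

      -- Induction from the end of the path, where `s` stands in as successor of `t`. The second
      -- component is kept because the exchange and `conclude` each need two consecutive rigid
      -- vertices.
      rigid : ∀ {x y l₁ l₂} → Walk s x l₁ → D x y → Walk y t l₂ → l₁ ++ l₂ ↭ L →
              Rigid x y × ∃ λ q → q ≁ y × Rigid y q
      rigid p₁ d ⟨ _ ⟩ perm =
        rigid-step s≁t rigid-end (splice p₁ ⟨ _ ⟩ perm)
          (λ C d e f b≁s → exchange-end p₁ perm C d e f λ s~b → b≁s (sym s~b)) ,
        s , s≁t , rigid-end
      rigid {y = y} {l₁} {_ ∷ l₂} p₁ d p₂@(_∷_ {y = z} e p₃) perm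
        with rigid (p₁ ++⟨ d ⟩ ⟨ y ⟩) e p₃ (↭-trans (↭-reflexive (++-assoc l₁ [ y ] l₂)) perm)
      ... | rigid-y , q , q≁z , rigid-z =
        rigid-step (λ z~y → arc⇒≢ e (sym z~y)) rigid-y (splice p₁ p₂ perm) exchanged ,
        z , (λ z~y → arc⇒≢ e (sym z~y)) , rigid-y
        where
        exchanged : ∀ {a b c} → CycleAround K a b c → D _ c → D a y → D y b → b ≁ z → Goal
        exchanged {b = b} C d f g b≁z with complete b z b≁z
        ... | inj₁ h = exchange p₁ p₃ perm C d f g h
        -- Rigidity of `y` and of `z` at this same `b` would give `a` the colours of both `z` and
        -- `q`.
        ... | inj₂ h with rigid-y (via-in C) g | rigid-z (via-in C) h
        ...   | inj₁ goal | _ = goal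
        ...   | inj₂ _ | inj₁ goal = goal
        ...   | inj₂ a~z | inj₂ a~q = ⊥-elim (q≁z (trans (sym a~q) a~z))

      -- The first candidate for the initial vertex is `c`. If it has the colour of `t`, its
      -- successor `u` does not, and a path from `u` to `t` is built instead.
      conclude : ∀ {y q l₂ b c} → Walk y t l₂ → s ∷ l₂ ≡ L → D s y → Rigid s y →
                 q ≁ y → Rigid y q → CycleThrough K b c → D b s → Goal
      conclude {y} {q} {b = b} {c} p₂ eq d rigid-s q≁y rigid-y C e
        with successor C | colour c ≟ᶜ colour t
      ... | _ | no c≁t = prepend P C e c≁t
      ... | u , C′ | yes c~t with complete s c (λ s~c → s≁t (trans s~c c~t))
      ...   | inj₂ f = prepend P (via-out C′) f
        λ u~t → arc⇒≢ (arc (via-out C′)) (trans c~t (sym u~t))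
      ...   | inj₁ f with rigid-s C f
      ...     | inj₁ goal = goal
      ...     | inj₂ b~y with complete c y (λ c~y → arc⇒≢ (arc C) (trans b~y (sym c~y)))
      ...       | inj₁ g = exchange-start p₂ (↭-reflexive eq) C′ e f g
        λ u~t → arc⇒≢ (arc (via-out C′)) (trans c~t (sym u~t))
      -- Now `s` points to `c` and so does `y`, so `b` would have the colours of both `y` and `q`.
      ...       | inj₂ g with rigid-y C g
      ...         | inj₁ goal = goal
      ...         | inj₂ b~q = ⊥-elim (q≁y (trans (sym b~q) b~y))

  merge : ∀ {s t L K b c} → s ≁ t → Walk s t L → CycleThrough K b c → BichromaticPath (L ++ K)
  merge s≁t ⟨ _ ⟩ _ = ⊥-elim (s≁t refl)
  merge s≁t P@(_∷_ {y = y} d p) C with rigid s≁t P ⟨ _ ⟩ d p ↭-refl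
  ... | rigid-s , q , q≁y , rigid-y with cycle-into-start s≁t (λ y~s → arc⇒≢ d (sym y~s)) rigid-s C
  ...   | inj₁ goal = goal
  ...   | inj₂ (_ , _ , C′ , e) = conclude s≁t P p refl d rigid-s q≁y rigid-y C′ e

-- `last` inspects a list from its right end, so the equation reduces only after a case split on
-- `initLast ys`.
last-∷ : ∀ {V : Set} (x y : V) ys → last (x ∷ y ∷ ys) ≡ last (y ∷ ys)
last-∷ x y ys with initLast ys
... | []      = refl
... | _ ∷ʳ′ _ = refl

-- Lists as walks, and absorption of all cycles.

module _ {n : ℕ} {D : Digraph n} (S : SemicompleteMultipartite D) where

  open SemicompleteMultipartite S

  arc⇒part≢ : ∀ {x y} → D x y → part x ≢ part y
  arc⇒part≢ {x} {y} d eq = indep x y eq d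

  open Merging D part _≟_ arc⇒part≢ complete

  fromConsec : ∀ x xs → Consec D (x ∷ xs) → Walk x (last (x ∷ xs)) (x ∷ xs)
  fromConsec x []       _       = ⟨ x ⟩
  fromConsec x (y ∷ ys) (d , c) =
    subst (λ z → Walk x z (x ∷ y ∷ ys)) (sym (last-∷ x y ys)) (d ∷ fromConsec y ys c)

  toConsec : ∀ {u v l} → Walk u v l →
             ∃ λ xs → l ≡ u ∷ xs × Consec D (u ∷ xs) × last (u ∷ xs) ≡ v
  toConsec ⟨ _ ⟩ = [] , refl , tt , refl
  toConsec {u} (_∷_ {y = y} d p) with toConsec p
  ... | ys , refl , c , eq = y ∷ ys , refl , (d , c) , trans (last-∷ u y ys) eq

  -- Each merge returns a path whose ends again differ in colour, as the next merge requires.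
  merge-all : ∀ {s t L} cs → s ≁ t → Walk s t L → All (IsCycle D) cs →
              BichromaticPath (L ++ concatMap toList cs)
  merge-all {L = L} [] s≁t p [] = _ , _ , L , p , ↭-reflexive (sym (++-identityʳ L)) , s≁t
  merge-all {L = L} ((c ∷ cs) ∷ css) s≁t p ((consec , d) ∷ oks)
    with merge s≁t p (cycle (fromConsec c cs consec) d ↭-refl)
  ... | _ , _ , l , q , perm , u≁v with merge-all css u≁v q oks
  ...   | u , v , m , r , perm′ , u≁v′ =
    u , v , m , r ,
    ↭-trans perm′ (↭-trans (++⁺ʳ rest perm) (↭-reflexive (++-assoc L (c ∷ cs) rest))) ,
    u≁v′
    where rest = concatMap toList css

theorem1p5 : (n : ℕ) (D : Digraph n) (S : SemicompleteMultipartite D)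
    → (F : OnePathCycleFactor D)
    → SemicompleteMultipartite.part S (head (OnePathCycleFactor.path F))
    ≢ SemicompleteMultipartite.part S (last (OnePathCycleFactor.path F))
    → Σ (HamiltonPath D) λ H →
    SemicompleteMultipartite.part S (head (HamiltonPath.path H))
    ≢ SemicompleteMultipartite.part S (last (HamiltonPath.path H))
theorem1p5 n D S F s≁t
  with F .OnePathCycleFactor.path | F .OnePathCycleFactor.path-ok | F .OnePathCycleFactor.spanning
... | x ∷ xs | walk | spanning
  with merge-all S (F .OnePathCycleFactor.cycles) s≁t (fromConsec S x xs walk)
         (F .OnePathCycleFactor.cycles-ok)
... | u , _ , _ , p , perm , u≁v with toConsec S p
... | ys , refl , consec , refl =
  record { path = u ∷ ys ; path-ok = consec ; spanning = ↭-trans perm spanning } , u≁v
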